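{- In the $L^2$ norm on $\mathbb{R}^2$, for every positive integer $n\leq 6$ there exists a strong crescent configuration of size $n$.
   Context: Let $\|\cdot\|$ be the $L^2$ (Euclidean) norm on $\mathbb{R}^2$. A $\|\cdot\|$ circle is a set $\{q\in\mathbb{R}^2:\|q-p\|=r\}$ with $p\in\mathbb{R}^2$, $r>0$. A set $S\subset\mathbb{R}^2$ of $n$ points is a line-like configuration of size $n$ in $\|\cdot\|$ if its distance graph is isomorphic to that of $n$ equally spaced points on a line, i.e. there is a bijection $\phi: S\to\{1,\dots,n\}$ such that for all $a,b,c,d\in S$: $\|a-b\|=\|c-d\|$ if and only if $|\phi(a)-\phi(b)|=|\phi(c)-\phi(d)|$. A set of points lies in strong general position in $\|\cdot\|$ if (1) no three of its points lie on a common line, (2) no four of its points lie on a common $\|\cdot\|$ circle, and (3) no four of its points form a line-like configuration of size four in $\|\cdot\|$. A set of $n$ points in $\mathbb{R}^2$ is a strong crescent configuration of size $n$ in $\|\cdot\|$ if (1) it lies in strong general position in $\|\cdot\|$, (2) it determines exactly $n-1$ distinct (nonzero) distances, measured in $\|\cdot\|$, and (3) for each $1\leq i\leq n-1$ there is a distance which occurs with multiplicity exactly $i$ among the unordered pairs of distinct points. -}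

module Defs where

open import Data.Nat.Base as ℕ using (ℕ; zero; suc)
import Data.Nat.Properties as ℕ
import Data.Nat.DivMod as ℕ
open import Data.Integer.Base as ℤ using (+_; -[1+_])
import Data.Integer.Properties as ℤ
open import Data.Rational.Base as ℚ using (ℚ; mkℚ; 0ℚ; 1ℚ; ½; toℚᵘ; fromℚᵘ)
import Data.Rational.Properties as ℚ
import Data.Rational.Unnormalised.Base as ℚᵘ
import Data.Rational.Unnormalised.Properties as ℚᵘ
open import Data.Rational.Solver using (module +-*-Solver)
open import Data.Fin.Base as Fin using (Fin; toℕ)
open import Data.List.Base using (List; length)
open import Data.List.Membership.Propositional using (_∈_)
open import Data.List.Relation.Unary.Unique.Propositional using (Unique)
open import Data.Product using (∃; ∃₂; Σ-syntax; ∃-syntax; _×_; _,_; proj₁; proj₂)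
open import Data.Sum.Base using (inj₁; inj₂)
open import Function.Base using (_∘_)
open import Function.Bundles using (_⇔_; _⤖_; _↣_; Bijection; Injection)
open import Function.Definitions using (Injective)
open import Relation.Binary.PropositionalEquality
  using (_≡_; _≢_; refl; sym; trans; cong; cong₂; subst; subst₂)
open import Relation.Nullary using (¬_; yes; no; contradiction)

------------------------------------------------------------------------
-- Rational estimates used to build the real operations

module Estimates where

  open import Data.Rational.Base using (_+_; _*_; _-_; -_; _<_; _≤_; _⊔_; ∣_∣)
  open ℚ.≤-Reasoning
  open +-*-Solver using (solve; _:=_; _:+_; _:*_; :-_; _:-_)

  half-pos : ∀ {ε} → 0ℚ < ε → 0ℚ < ½ * ε
  half-pos {ε} ε>0 =
    ℚ.positive⁻¹ _ {{ℚ.pos*pos⇒pos ½ ε {{ℚ.positive ε>0}}}}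

  half+half : ∀ ε → ½ * ε + ½ * ε ≡ ε
  half+half ε = trans (sym (ℚ.*-distribʳ-+ ε ½ ½)) (ℚ.*-identityˡ ε)

  ∣-∣-sym : ∀ a b → ∣ a - b ∣ ≡ ∣ b - a ∣
  ∣-∣-sym a b = trans (sym (ℚ.∣-p∣≡∣p∣ (a - b))) (cong ∣_∣ (eq a b))
    where
    eq : ∀ a b → - (a - b) ≡ b - a
    eq = solve 2 (λ a b → :- (a :- b) := b :- a) refl

  a≤∣a∣ : ∀ a → a ≤ ∣ a ∣
  a≤∣a∣ a with ℚ.≤-total 0ℚ a
  ... | inj₁ 0≤a = ℚ.≤-reflexive (sym (ℚ.0≤p⇒∣p∣≡p 0≤a))
  ... | inj₂ a≤0 = ℚ.≤-trans a≤0 (ℚ.0≤∣p∣ a)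

  square-nonNeg : ∀ a → 0ℚ ≤ a * a
  square-nonNeg a with ℚ.≤-total 0ℚ a
  ... | inj₁ 0≤a = ℚ.nonNegative⁻¹ _
    {{ℚ.nonNeg*nonNeg⇒nonNeg a {{ℚ.nonNegative 0≤a}} a {{ℚ.nonNegative 0≤a}}}}
  ... | inj₂ a≤0 = ℚ.nonNegative⁻¹ _
    {{ℚ.nonPos*nonPos⇒nonPos a {{ℚ.nonPositive a≤0}} a {{ℚ.nonPositive a≤0}}}}

  +-estimate : ∀ a b c d {ε} → ∣ a - c ∣ < ½ * ε → ∣ b - d ∣ < ½ * ε →
               ∣ (a + b) - (c + d) ∣ < ε
  +-estimate a b c d {ε} p q = begin-strict
    ∣ (a + b) - (c + d) ∣    ≡⟨ cong ∣_∣ (eq a b c d) ⟩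
    ∣ (a - c) + (b - d) ∣    ≤⟨ ℚ.∣p+q∣≤∣p∣+∣q∣ (a - c) (b - d) ⟩
    ∣ a - c ∣ + ∣ b - d ∣    <⟨ ℚ.+-mono-< p q ⟩
    ½ * ε + ½ * ε            ≡⟨ half+half ε ⟩
    ε                        ∎
    where
    eq : ∀ a b c d → (a + b) - (c + d) ≡ (a - c) + (b - d)
    eq = solve 4 (λ a b c d → (a :+ b) :- (c :+ d) := (a :- c) :+ (b :- d)) refl

  neg-estimate : ∀ a c → ∣ (- a) - (- c) ∣ ≡ ∣ a - c ∣
  neg-estimate a c = trans (cong ∣_∣ (eq a c)) (∣-∣-sym c a)
    where
    eq : ∀ a c → (- a) - (- c) ≡ c - a
    eq = solve 2 (λ a c → (:- a) :- (:- c) := c :- a) refl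

  near⇒bounded : ∀ a c → ∣ a - c ∣ < 1ℚ → ∣ a ∣ < ∣ c ∣ + 1ℚ
  near⇒bounded a c p = begin-strict
    ∣ a ∣                ≡⟨ cong ∣_∣ (eq a c) ⟩
    ∣ c + (a - c) ∣      ≤⟨ ℚ.∣p+q∣≤∣p∣+∣q∣ c (a - c) ⟩
    ∣ c ∣ + ∣ a - c ∣    <⟨ ℚ.+-monoʳ-< ∣ c ∣ p ⟩
    ∣ c ∣ + 1ℚ           ∎
    where
    eq : ∀ a c → a ≡ c + (a - c)
    eq = solve 2 (λ a c → a := c :+ (a :- c)) refl

  scale-pos : ∀ B {ε} → 0ℚ < B → 0ℚ < ε → Σ[ δ ∈ ℚ ] (0ℚ < δ × B * δ ≡ ε)
  scale-pos B {ε} B>0 ε>0 = δ , δ>0 , eq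
    where
    instance
      B-pos = ℚ.positive B>0
      ε-pos = ℚ.positive ε>0
      B≢0   = ℚ.pos⇒nonZero B
      1/B   = ℚ.1/pos⇒pos B
    δ = (ℚ.1/ B) * ε
    δ>0 : 0ℚ < δ
    δ>0 = ℚ.positive⁻¹ δ {{ℚ.pos*pos⇒pos (ℚ.1/ B) ε}}
    eq : B * δ ≡ ε
    eq = trans (sym (ℚ.*-assoc B (ℚ.1/ B) ε))
               (trans (cong (_* ε) (ℚ.*-inverseʳ B)) (ℚ.*-identityˡ ε))

  *-estimate : ∀ a b c d {A B δ} → ∣ a ∣ < A → ∣ d ∣ < B → 0ℚ < δ →
               ∣ a - c ∣ < δ → ∣ b - d ∣ < δ →
               ∣ a * b - c * d ∣ < (A + B) * δ
  *-estimate a b c d {A} {B} {δ} a<A d<B δ>0 p q = begin-strict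
    ∣ a * b - c * d ∣                        ≡⟨ cong ∣_∣ (eq a b c d) ⟩
    ∣ a * (b - d) + d * (a - c) ∣            ≤⟨ ℚ.∣p+q∣≤∣p∣+∣q∣ (a * (b - d)) (d * (a - c)) ⟩
    ∣ a * (b - d) ∣ + ∣ d * (a - c) ∣        ≡⟨ cong₂ _+_ (ℚ.∣p*q∣≡∣p∣*∣q∣ a (b - d)) (ℚ.∣p*q∣≡∣p∣*∣q∣ d (a - c)) ⟩
    ∣ a ∣ * ∣ b - d ∣ + ∣ d ∣ * ∣ a - c ∣    ≤⟨ ℚ.+-mono-≤ (le a (b - d) q) (le d (a - c) p) ⟩
    ∣ a ∣ * δ + ∣ d ∣ * δ                    <⟨ ℚ.+-mono-< (lt a<A) (lt d<B) ⟩
    A * δ + B * δ                            ≡⟨ sym (ℚ.*-distribʳ-+ δ A B) ⟩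
    (A + B) * δ                              ∎
    where
    instance δ-pos = ℚ.positive δ>0
    eq : ∀ a b c d → a * b - c * d ≡ a * (b - d) + d * (a - c)
    eq = solve 4 (λ a b c d → a :* b :- c :* d := a :* (b :- d) :+ d :* (a :- c)) refl
    le : ∀ u v → ∣ v ∣ < δ → ∣ u ∣ * ∣ v ∣ ≤ ∣ u ∣ * δ
    le u v v<δ = ℚ.*-monoˡ-≤-nonNeg ∣ u ∣ {{ℚ.∣-∣-nonNeg u}} (ℚ.<⇒≤ v<δ)
    lt : ∀ {u v} → u < v → u * δ < v * δ
    lt = ℚ.*-monoˡ-<-pos δ

  -- 1 / (n + 1) is eventually below any positive rational
  1/suc-small : ∀ {δ} → 0ℚ < δ → Σ[ N ∈ ℕ ] (∀ n → N ℕ.≤ n → (+ 1 ℚ./ suc n) < δ)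
  1/suc-small {mkℚ (+ zero) d c} (ℚ.*<* (ℤ.+<+ ()))
  1/suc-small {mkℚ -[1+ k ] d c} (ℚ.*<* ())
  1/suc-small {δ@(mkℚ (+ suc k) d c)} _ = suc d , λ n d<n →
    ℚ.toℚᵘ-cancel-< (ℚᵘ.<-respˡ-≃ (ℚᵘ.≃-sym (ℚ.toℚᵘ-fromℚᵘ (ℚᵘ.mkℚᵘ (+ 1) n)))
      (ℚᵘ.*<* (subst₂ ℤ._<_ (sym (ℤ.*-identityˡ (+ suc d))) (ℤ.pos-* (suc k) (suc n))
        (ℤ.+<+ (ℕ.≤-trans (ℕ.s≤s d<n) (ℕ.m≤n*m (suc n) (suc k)))))))

------------------------------------------------------------------------
-- Rational square-root approximations

isqrt : ℕ → ℕ
isqrt zero = 0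
isqrt (suc m) with suc (isqrt m) ℕ.* suc (isqrt m) ℕ.≤? suc m
... | yes _ = suc (isqrt m)
... | no  _ = isqrt m

isqrt-lower : ∀ m → isqrt m ℕ.* isqrt m ℕ.≤ m
isqrt-lower zero = ℕ.z≤n
isqrt-lower (suc m) with suc (isqrt m) ℕ.* suc (isqrt m) ℕ.≤? suc m
... | yes p = p
... | no  _ = ℕ.m≤n⇒m≤1+n (isqrt-lower m)

isqrt-upper : ∀ m → m ℕ.< suc (isqrt m) ℕ.* suc (isqrt m)
isqrt-upper zero = ℕ.s≤s ℕ.z≤n
isqrt-upper (suc m) with suc (isqrt m) ℕ.* suc (isqrt m) ℕ.≤? suc m
... | yes _ = ℕ.<-≤-trans (ℕ.s≤s (isqrt-upper m))
                (ℕ.*-mono-< (ℕ.n<1+n (suc (isqrt m))) (ℕ.n<1+n (suc (isqrt m))))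
... | no ¬p = ℕ.≰⇒> ¬p

-- ⌊ √q · (n + 1) ⌋ / (n + 1), and 0 for negative q
√-approx : ℕ → ℚ → ℚ
√-approx n (mkℚ (+ a) d _)    = + isqrt (a ℕ.* (suc n ℕ.* suc n) ℕ./ suc d) ℚ./ suc n
√-approx n (mkℚ -[1+ _ ] _ _) = 0ℚ

module √-Estimates where

  open import Data.Rational.Base using (_+_; _*_; _-_; -_; _<_; _≤_; ∣_∣; _/_)
  open ℚ.≤-Reasoning
  open +-*-Solver using (solve; _:=_; _:+_; _:*_; :-_; _:-_)
  open Estimates

  private
    /-*-/ : ∀ k n → toℚᵘ ((+ k / suc n) * (+ k / suc n))
                    ℚᵘ.≃ ℚᵘ.mkℚᵘ (+ k) n ℚᵘ.* ℚᵘ.mkℚᵘ (+ k) n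
    /-*-/ k n = ℚᵘ.≃-trans (ℚ.toℚᵘ-homo-* (+ k / suc n) (+ k / suc n))
      (ℚᵘ.*-cong (ℚ.toℚᵘ-fromℚᵘ (ℚᵘ.mkℚᵘ (+ k) n)) (ℚ.toℚᵘ-fromℚᵘ (ℚᵘ.mkℚᵘ (+ k) n)))

    pos-*³ : ∀ k l m → + (k ℕ.* l ℕ.* m) ≡ + k ℤ.* + l ℤ.* + m
    pos-*³ k l m = trans (ℤ.pos-* (k ℕ.* l) m) (cong (ℤ._* + m) (ℤ.pos-* k l))

  √-approx-nonNeg : ∀ n q → 0ℚ ≤ √-approx n q
  √-approx-nonNeg n (mkℚ (+ a) d _) =
    ℚ.nonNegative⁻¹ _ {{ℚ.normalize-nonNeg (isqrt (a ℕ.* (suc n ℕ.* suc n) ℕ./ suc d)) (suc n)}}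
  √-approx-nonNeg n (mkℚ -[1+ _ ] _ _) = ℚ.≤-refl

  √-approx-lower : ∀ n q → 0ℚ ≤ q → √-approx n q * √-approx n q ≤ q
  √-approx-lower n (mkℚ -[1+ _ ] d _) (ℚ.*≤* ())
  √-approx-lower n q@(mkℚ (+ a) d _) _ = ℚ.toℚᵘ-cancel-≤
    (ℚᵘ.≤-respˡ-≃ (ℚᵘ.≃-sym (/-*-/ k n))
      (ℚᵘ.*≤* (subst₂ ℤ._≤_ (pos-*³ k k (suc d)) (ℤ.pos-* a _) (ℤ.+≤+ le))))
    where
    t = a ℕ.* (suc n ℕ.* suc n)
    k = isqrt (t ℕ./ suc d)
    le : k ℕ.* k ℕ.* suc d ℕ.≤ t
    le = ℕ.≤-trans (ℕ.*-monoˡ-≤ (suc d) (isqrt-lower (t ℕ./ suc d))) (ℕ.m/n*n≤m t (suc d))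

  √-approx-nonPos : ∀ n q → q ≤ 0ℚ → √-approx n q ≤ 0ℚ
  √-approx-nonPos n (mkℚ -[1+ _ ] _ _) _ = ℚ.≤-refl
  √-approx-nonPos n (mkℚ (+ suc a) d _) (ℚ.*≤* (ℤ.+≤+ ()))
  √-approx-nonPos n (mkℚ (+ zero) d _) _ = ℚ.≤-reflexive (ℚ.0/n≡0 (suc n))

  √-approx-upper : ∀ n q →
    q < (√-approx n q + (+ 1 / suc n)) * (√-approx n q + (+ 1 / suc n))
  √-approx-upper n q@(mkℚ -[1+ _ ] _ _) =
    ℚ.<-trans (ℚ.negative⁻¹ q) (ℚ.positive⁻¹ (u * u) {{ℚ.pos*pos⇒pos u {{u>0}} u {{u>0}}}})
    where
    u = 0ℚ + (+ 1 / suc n)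
    u>0 : ℚ.Positive u
    u>0 = ℚ.nonNeg+pos⇒pos 0ℚ (+ 1 / suc n) {{ℚ.normalize-pos 1 (suc n)}}
  √-approx-upper n q@(mkℚ (+ a) d _) = subst (λ u → q < u * u) suc-k/n
    (ℚ.toℚᵘ-cancel-< (ℚᵘ.<-respʳ-≃ (ℚᵘ.≃-sym (/-*-/ (suc k) n))
      (ℚᵘ.*<* (subst₂ ℤ._<_ (ℤ.pos-* a _) (pos-*³ (suc k) (suc k) (suc d)) (ℤ.+<+ lt)))))
    where
    t = a ℕ.* (suc n ℕ.* suc n)
    k = isqrt (t ℕ./ suc d)
    lt : t ℕ.< suc k ℕ.* suc k ℕ.* suc d
    lt = ℕ.≤-trans (ℕ.s≤s (ℕ.≤-reflexive (ℕ.m≡m%n+[m/n]*n t (suc d))))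
           (ℕ.≤-trans (ℕ.+-monoˡ-≤ ((t ℕ./ suc d) ℕ.* suc d) (ℕ.m%n<n t (suc d)))
             (ℕ.*-monoˡ-≤ (suc d) (isqrt-upper (t ℕ./ suc d))))
    suc-k/n : + suc k / suc n ≡ (+ k / suc n) + (+ 1 / suc n)
    suc-k/n = ℚ.toℚᵘ-injective (ℚᵘ.≃-trans (ℚ.toℚᵘ-fromℚᵘ (ℚᵘ.mkℚᵘ (+ suc k) n))
      (ℚᵘ.≃-sym (ℚᵘ.≃-trans (ℚ.toℚᵘ-homo-+ (+ k / suc n) (+ 1 / suc n))
        (ℚᵘ.≃-trans
          (ℚᵘ.+-cong (ℚ.toℚᵘ-fromℚᵘ (ℚᵘ.mkℚᵘ (+ k) n)) (ℚ.toℚᵘ-fromℚᵘ (ℚᵘ.mkℚᵘ (+ 1) n)))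
          (ℚᵘ.*≡* eq)))))
      where
      N = + suc n
      eq : (+ k ℤ.* N ℤ.+ + 1 ℤ.* N) ℤ.* N ≡ + suc k ℤ.* (N ℤ.* N)
      eq = trans (cong (ℤ._* N) (trans (sym (ℤ.*-distribʳ-+ N (+ k) (+ 1)))
                   (cong (ℤ._* N) (cong +_ (ℕ.+-comm k 1)))))
                 (ℤ.*-assoc (+ suc k) N N)

  square-mono : ∀ {u v} → 0ℚ ≤ u → u ≤ v → u * u ≤ v * v
  square-mono {u} {v} 0≤u u≤v =
    ℚ.≤-trans (ℚ.*-monoˡ-≤-nonNeg u {{ℚ.nonNegative 0≤u}} u≤v)
              (ℚ.*-monoʳ-≤-nonNeg v {{ℚ.nonNegative (ℚ.≤-trans 0≤u u≤v)}} u≤v)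

  -- (u + δ)² ≥ u² + δ² for nonnegative u, δ
  square-superadditive : ∀ {u δ} → 0ℚ ≤ u → 0ℚ ≤ δ → u * u + δ * δ ≤ (u + δ) * (u + δ)
  square-superadditive {u} {δ} 0≤u 0≤δ = begin
    u * u + δ * δ                        ≡⟨ sym (ℚ.+-identityʳ _) ⟩
    (u * u + δ * δ) + 0ℚ                 ≤⟨ ℚ.+-monoʳ-≤ (u * u + δ * δ) cross ⟩
    (u * u + δ * δ) + (u * δ + u * δ)    ≡⟨ eq u δ ⟩
    (u + δ) * (u + δ)                    ∎
    where
    instance
      u-nn = ℚ.nonNegative 0≤u
      δ-nn = ℚ.nonNegative 0≤δ
      uδ-nn = ℚ.nonNeg*nonNeg⇒nonNeg u δ
    cross : 0ℚ ≤ u * δ + u * δ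
    cross = ℚ.nonNegative⁻¹ _ {{ℚ.nonNeg+nonNeg⇒nonNeg (u * δ) (u * δ)}}
    eq : ∀ u δ → (u * u + δ * δ) + (u * δ + u * δ) ≡ (u + δ) * (u + δ)
    eq = solve 2 (λ u δ → (u :* u :+ δ :* δ) :+ (u :* δ :+ u :* δ) := (u :+ δ) :* (u :+ δ)) refl

  √-approx-gap : ∀ m n q r {δ} → 0ℚ < δ → (+ 1 / suc n) < δ → ∣ q - r ∣ < δ * δ →
                 √-approx m q - √-approx n r < δ + δ
  √-approx-gap m n q r {δ} δ>0 1/n<δ q-r<δ² with (s - t) ℚ.<? (δ + δ)
    where
    s = √-approx m q
    t = √-approx n r
  ... | yes p = p
  ... | no ¬p = contradiction (ℚ.≤-total 0ℚ q)
                  λ { (inj₁ 0≤q) → ℚ.<-irrefl refl (0≤q-absurd 0≤q)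
                    ; (inj₂ q≤0) → ℚ.<-irrefl refl (q≤0-absurd q≤0) }
    where
    s = √-approx m q
    t = √-approx n r
    e = + 1 / suc n
    v = t + e
    0≤e : 0ℚ ≤ e
    0≤e = ℚ.nonNegative⁻¹ e {{ℚ.normalize-nonNeg 1 (suc n)}}
    0≤v : 0ℚ ≤ v
    0≤v = ℚ.+-mono-≤ (√-approx-nonNeg n r) 0≤e
    eq₁ : ∀ s t → (s - t) + t ≡ s
    eq₁ = solve 2 (λ s t → (s :- t) :+ t := s) refl
    eq₂ : ∀ t δ → (δ + δ) + t ≡ (t + δ) + δ
    eq₂ = solve 2 (λ t δ → (δ :+ δ) :+ t := (t :+ δ) :+ δ) refl
    v+δ≤s : v + δ ≤ s
    v+δ≤s = begin
      (t + e) + δ    ≤⟨ ℚ.+-monoˡ-≤ δ (ℚ.+-monoʳ-≤ t (ℚ.<⇒≤ 1/n<δ)) ⟩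
      (t + δ) + δ    ≡⟨ sym (eq₂ t δ) ⟩
      (δ + δ) + t    ≤⟨ ℚ.+-monoˡ-≤ t (ℚ.≮⇒≥ ¬p) ⟩
      (s - t) + t    ≡⟨ eq₁ s t ⟩
      s              ∎
    q≤0-absurd : q ≤ 0ℚ → 0ℚ < 0ℚ
    q≤0-absurd q≤0 = begin-strict
      0ℚ       <⟨ δ>0 ⟩
      δ        ≡⟨ sym (ℚ.+-identityˡ δ) ⟩
      0ℚ + δ   ≤⟨ ℚ.+-monoˡ-≤ δ 0≤v ⟩
      v + δ    ≤⟨ v+δ≤s ⟩
      s        ≤⟨ √-approx-nonPos m q q≤0 ⟩
      0ℚ       ∎
    eq₃ : ∀ q r → r + (q - r) ≡ q
    eq₃ = solve 2 (λ q r → r :+ (q :- r) := q) refl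
    0≤q-absurd : 0ℚ ≤ q → q < q
    0≤q-absurd 0≤q = begin-strict
      q                    ≡⟨ sym (eq₃ q r) ⟩
      r + (q - r)          ≤⟨ ℚ.+-monoʳ-≤ r (a≤∣a∣ (q - r)) ⟩
      r + ∣ q - r ∣        <⟨ ℚ.+-mono-< (√-approx-upper n r) q-r<δ² ⟩
      v * v + δ * δ        ≤⟨ square-superadditive 0≤v (ℚ.<⇒≤ δ>0) ⟩
      (v + δ) * (v + δ)    ≤⟨ square-mono (ℚ.+-mono-≤ 0≤v (ℚ.<⇒≤ δ>0)) v+δ≤s ⟩
      s * s                ≤⟨ √-approx-lower m q 0≤q ⟩
      q                    ∎

  ∣-∣<-intro : ∀ a b {ε} → a - b < ε → b - a < ε → ∣ a - b ∣ < ε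
  ∣-∣<-intro a b p q with ℚ.∣p∣≡p∨∣p∣≡-p (a - b)
  ... | inj₁ eq = subst (_< _) (sym eq) p
  ... | inj₂ eq = subst (_< _) (sym (trans eq (neg a b))) q
    where
    neg : ∀ a b → - (a - b) ≡ b - a
    neg = solve 2 (λ a b → :- (a :- b) := b :- a) refl

  √-approx-square : ∀ n q {B δ} → 0ℚ ≤ q → ∣ √-approx n q ∣ < B → 0ℚ < δ →
                    (+ 1 / suc n) < δ → (+ 1 / suc n) < 1ℚ →
                    ∣ √-approx n q * √-approx n q - q ∣ < ((B + B) + 1ℚ) * δ
  √-approx-square n q {B} {δ} 0≤q s<B δ>0 e<δ e<1 = ∣-∣<-intro (s * s) q below above
    where
    s = √-approx n q
    e = + 1 / suc n
    e>0 : 0ℚ < e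
    e>0 = ℚ.positive⁻¹ e {{ℚ.normalize-pos 1 (suc n)}}
    B>0 : 0ℚ < B
    B>0 = ℚ.≤-<-trans (ℚ.0≤∣p∣ s) s<B
    s≤B : s ≤ B
    s≤B = ℚ.≤-trans (a≤∣a∣ s) (ℚ.<⇒≤ s<B)
    instance
      δ-pos = ℚ.positive δ>0
      e-nn  = ℚ.pos⇒nonNeg e {{ℚ.positive e>0}}
      B-pos = ℚ.positive B>0
      2B-pos = ℚ.pos+pos⇒pos B B
      K-pos = ℚ.pos+pos⇒pos (B + B) 1ℚ
      K-nn = ℚ.pos⇒nonNeg ((B + B) + 1ℚ)
    K = (B + B) + 1ℚ
    below : s * s - q < K * δ
    below = begin-strict
      s * s - q    ≤⟨ ℚ.+-monoˡ-≤ (- q) (√-approx-lower n q 0≤q) ⟩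
      q - q        ≡⟨ ℚ.+-inverseʳ q ⟩
      0ℚ           <⟨ ℚ.positive⁻¹ (K * δ) {{ℚ.pos*pos⇒pos K δ}} ⟩
      K * δ        ∎
    eq : ∀ s e → (s + e) * (s + e) - s * s ≡ ((s + s) + e) * e
    eq = solve 2 (λ s e → (s :+ e) :* (s :+ e) :- s :* s := ((s :+ s) :+ e) :* e) refl
    above : q - s * s < K * δ
    above = begin-strict
      q - s * s                    <⟨ ℚ.+-monoˡ-< (- (s * s)) (√-approx-upper n q) ⟩
      (s + e) * (s + e) - s * s    ≡⟨ eq s e ⟩
      ((s + s) + e) * e            ≤⟨ ℚ.*-monoʳ-≤-nonNeg e (ℚ.+-mono-≤ (ℚ.+-mono-≤ s≤B s≤B) (ℚ.<⇒≤ e<1)) ⟩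
      K * e                        ≤⟨ ℚ.*-monoˡ-≤-nonNeg K (ℚ.<⇒≤ e<δ) ⟩
      K * δ                        ∎

------------------------------------------------------------------------
-- Real numbers: Cauchy sequences of rationals, with _≈_ as equality

-- The Cauchy moduli are part of the data, so operations act termwise.

record ℝ : Set where
  constructor mkℝ
  field
    seq    : ℕ → ℚ
    cauchy : ∀ ε → 0ℚ ℚ.< ε →
             Σ[ N ∈ ℕ ] (∀ m n → N ℕ.≤ m → N ℕ.≤ n → ℚ.∣ seq m ℚ.- seq n ∣ ℚ.< ε)

open ℝ public

infix 4 _≈_ _<_
infixl 6 _+_ _-_
infixl 7 _*_
infix 8 -_

_≈_ : ℝ → ℝ → Set
x ≈ y = ∀ ε → 0ℚ ℚ.< ε →
        Σ[ N ∈ ℕ ] (∀ n → N ℕ.≤ n → ℚ.∣ seq x n ℚ.- seq y n ∣ ℚ.< ε)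

_<_ : ℝ → ℝ → Set
x < y = Σ[ ε ∈ ℚ ] (0ℚ ℚ.< ε ×
        Σ[ N ∈ ℕ ] (∀ n → N ℕ.≤ n → ε ℚ.< seq y n ℚ.- seq x n))

fromℚ : ℚ → ℝ
fromℚ q = mkℝ (λ _ → q) λ ε ε>0 →
  0 , λ _ _ _ _ → subst (ℚ._< ε) (sym (cong ℚ.∣_∣ (ℚ.+-inverseʳ q))) ε>0

0ℝ : ℝ
0ℝ = fromℚ 0ℚ

_+_ : ℝ → ℝ → ℝ
x + y = mkℝ (λ n → seq x n ℚ.+ seq y n) λ ε ε>0 →
  let N₁ , h₁ = cauchy x (½ ℚ.* ε) (half-pos ε>0)
      N₂ , h₂ = cauchy y (½ ℚ.* ε) (half-pos ε>0)
  in N₁ ℕ.⊔ N₂ , λ m n N≤m N≤n →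
     +-estimate (seq x m) (seq y m) (seq x n) (seq y n)
       (h₁ m n (ℕ.m⊔n≤o⇒m≤o N₁ N₂ N≤m) (ℕ.m⊔n≤o⇒m≤o N₁ N₂ N≤n))
       (h₂ m n (ℕ.m⊔n≤o⇒n≤o N₁ N₂ N≤m) (ℕ.m⊔n≤o⇒n≤o N₁ N₂ N≤n))
  where open Estimates

-_ : ℝ → ℝ
- x = mkℝ (λ n → ℚ.- seq x n) λ ε ε>0 →
  let N , h = cauchy x ε ε>0
  in N , λ m n N≤m N≤n →
     subst (ℚ._< ε) (sym (neg-estimate (seq x m) (seq x n))) (h m n N≤m N≤n)
  where open Estimates

_-_ : ℝ → ℝ → ℝ
x - y = x + (- y)

eventually-bounded : ∀ x → Σ[ B ∈ ℚ ] (0ℚ ℚ.< B ×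
                     Σ[ N ∈ ℕ ] (∀ n → N ℕ.≤ n → ℚ.∣ seq x n ∣ ℚ.< B))
eventually-bounded x =
  let N , h = cauchy x 1ℚ (ℚ.positive⁻¹ 1ℚ)
      c     = seq x N
  in ℚ.∣ c ∣ ℚ.+ 1ℚ
   , ℚ.positive⁻¹ _ {{ℚ.nonNeg+pos⇒pos ℚ.∣ c ∣ {{ℚ.∣-∣-nonNeg c}} 1ℚ}}
   , N , λ n N≤n → Estimates.near⇒bounded (seq x n) c (h n N N≤n ℕ.≤-refl)

_*_ : ℝ → ℝ → ℝ
x * y = mkℝ (λ n → seq x n ℚ.* seq y n) λ ε ε>0 →
  let A , A>0 , M₁ , a = eventually-bounded x
      B , B>0 , M₂ , b = eventually-bounded y
      A+B>0 = ℚ.positive⁻¹ _ {{ℚ.pos+pos⇒pos A {{ℚ.positive A>0}} B {{ℚ.positive B>0}}}}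
      δ , δ>0 , eq = scale-pos (A ℚ.+ B) A+B>0 ε>0
      N₁ , h₁ = cauchy x δ δ>0
      N₂ , h₂ = cauchy y δ δ>0
      M = M₁ ℕ.⊔ M₂
      N = N₁ ℕ.⊔ N₂
  in M ℕ.⊔ N , λ m n ≤m ≤n →
     let M≤m = ℕ.m⊔n≤o⇒m≤o M N ≤m
         M≤n = ℕ.m⊔n≤o⇒m≤o M N ≤n
         N≤m = ℕ.m⊔n≤o⇒n≤o M N ≤m
         N≤n = ℕ.m⊔n≤o⇒n≤o M N ≤n
     in subst (ℚ.∣ seq x m ℚ.* seq y m ℚ.- seq x n ℚ.* seq y n ∣ ℚ.<_) eq
          (*-estimate (seq x m) (seq y m) (seq x n) (seq y n)
            (a m (ℕ.m⊔n≤o⇒m≤o M₁ M₂ M≤m)) (b n (ℕ.m⊔n≤o⇒n≤o M₁ M₂ M≤n)) δ>0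
            (h₁ m n (ℕ.m⊔n≤o⇒m≤o N₁ N₂ N≤m) (ℕ.m⊔n≤o⇒m≤o N₁ N₂ N≤n))
            (h₂ m n (ℕ.m⊔n≤o⇒n≤o N₁ N₂ N≤m) (ℕ.m⊔n≤o⇒n≤o N₁ N₂ N≤n)))
  where open Estimates

√_ : ℝ → ℝ
√ x = mkℝ (λ n → √-approx n (seq x n)) λ ε ε>0 →
  let δ     = ½ ℚ.* ε
      δ>0   = half-pos ε>0
      N₁ , h  = cauchy x (δ ℚ.* δ)
                  (ℚ.positive⁻¹ _ {{ℚ.pos*pos⇒pos δ {{ℚ.positive δ>0}} δ {{ℚ.positive δ>0}}}})
      N₂ , 1/ = 1/suc-small δ>0
      gap : ∀ m n → N₁ ℕ.⊔ N₂ ℕ.≤ m → N₁ ℕ.⊔ N₂ ℕ.≤ n →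
            √-approx m (seq x m) ℚ.- √-approx n (seq x n) ℚ.< ε
      gap m n N≤m N≤n = subst (√-approx m (seq x m) ℚ.- √-approx n (seq x n) ℚ.<_) (half+half ε)
        (√-approx-gap m n (seq x m) (seq x n) δ>0 (1/ n (ℕ.m⊔n≤o⇒n≤o N₁ N₂ N≤n))
          (h m n (ℕ.m⊔n≤o⇒m≤o N₁ N₂ N≤m) (ℕ.m⊔n≤o⇒m≤o N₁ N₂ N≤n)))
  in N₁ ℕ.⊔ N₂ , λ m n N≤m N≤n →
     ∣-∣<-intro (√-approx m (seq x m)) (√-approx n (seq x n)) (gap m n N≤m N≤n) (gap n m N≤n N≤m)
  where
  open Estimates
  open √-Estimates


√-square : ∀ x → (∀ n → 0ℚ ℚ.≤ seq x n) → √ x * √ x ≈ x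
√-square x x≥0 ε ε>0 =
  let B , B>0 , M , b = eventually-bounded (√ x)
      instance B-pos = ℚ.positive B>0
      instance 2B-pos = ℚ.pos+pos⇒pos B B
      δ , δ>0 , eq = scale-pos ((B ℚ.+ B) ℚ.+ 1ℚ)
                       (ℚ.positive⁻¹ _ {{ℚ.pos+pos⇒pos (B ℚ.+ B) 1ℚ}}) ε>0
      N₁ , h₁ = 1/suc-small δ>0
      N₂ , h₂ = 1/suc-small (ℚ.positive⁻¹ 1ℚ)
      N = N₁ ℕ.⊔ N₂
  in M ℕ.⊔ N , λ n ≤n →
     let N≤n = ℕ.m⊔n≤o⇒n≤o M N ≤n
     in subst (ℚ.∣ √-approx n (seq x n) ℚ.* √-approx n (seq x n) ℚ.- seq x n ∣ ℚ.<_) eq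
          (√-approx-square n (seq x n) (x≥0 n) (b n (ℕ.m⊔n≤o⇒m≤o M N ≤n)) δ>0
            (h₁ n (ℕ.m⊔n≤o⇒m≤o N₁ N₂ N≤n)) (h₂ n (ℕ.m⊔n≤o⇒n≤o N₁ N₂ N≤n)))
  where
  open Estimates
  open √-Estimates

------------------------------------------------------------------------
-- The Euclidean plane

ℝ² : Set
ℝ² = ℝ × ℝ

infix 4 _≈²_

_≈²_ : ℝ² → ℝ² → Set
(x , y) ≈² (x′ , y′) = x ≈ x′ × y ≈ y′

‖_‖ : ℝ² → ℝ
‖ (x , y) ‖ = √ (x * x + y * y)

‖‖-square : ∀ x y → ‖ (x , y) ‖ * ‖ (x , y) ‖ ≈ x * x + y * y
‖‖-square x y = √-square (x * x + y * y) λ n →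
  ℚ.+-mono-≤ (Estimates.square-nonNeg (seq x n)) (Estimates.square-nonNeg (seq y n))

dist : ℝ² → ℝ² → ℝ
dist (x , y) (x′ , y′) = ‖ (x - x′ , y - y′) ‖

-- The line a x + b y = c
record Line : Set where
  field
    a b c         : ℝ
    nondegenerate : ¬ (a ≈ 0ℝ × b ≈ 0ℝ)

record Circle : Set where
  field
    centre   : ℝ²
    radius   : ℝ
    radius>0 : 0ℝ < radius

_onLine_ : ℝ² → Line → Set
(x , y) onLine ℓ = a * x + b * y ≈ c
  where open Line ℓ

_onCircle_ : ℝ² → Circle → Set
q onCircle C = dist q centre ≈ radius
  where open Circle C

------------------------------------------------------------------------
-- Configurations

-- A set of n points, listed as p : Fin n → ℝ²; see StrongCrescent.distinct.
Config : ℕ → Set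
Config n = Fin n → ℝ²

Collinear : ∀ {n} → Config n → Set
Collinear p = ∃[ ℓ ] (∀ i → p i onLine ℓ)

Concyclic : ∀ {n} → Config n → Set
Concyclic p = ∃[ C ] (∀ i → p i onCircle C)

-- Labels are 0 , … , n - 1 instead of 1 , … , n, which leaves their
-- differences unchanged.
LineLike : ∀ {n} → Config n → Set
LineLike {n} p = Σ[ φ ∈ Fin n ⤖ Fin n ]
  let label = toℕ ∘ Bijection.to φ in
  ∀ a b c d → dist (p a) (p b) ≈ dist (p c) (p d)
            ⇔ ℕ.∣ label a - label b ∣ ≡ ℕ.∣ label c - label d ∣

record StrongGeneralPosition {n} (p : Config n) : Set where
  field
    no-3-collinear : (s : Fin 3 ↣ Fin n) → ¬ Collinear (p ∘ Injection.to s)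
    no-4-concyclic : (s : Fin 4 ↣ Fin n) → ¬ Concyclic (p ∘ Injection.to s)
    no-4-line-like : (s : Fin 4 ↣ Fin n) → ¬ LineLike (p ∘ Injection.to s)

-- p determines exactly k distances: d enumerates them without repetition.
DeterminesDistances : ∀ {n} → Config n → ℕ → Set
DeterminesDistances {n} p k = Σ[ d ∈ (Fin k → ℝ) ]
  ( Injective _≡_ _≈_ d
  × (∀ t → ∃₂ λ i j → i ≢ j × dist (p i) (p j) ≈ d t)
  × (∀ i j → i ≢ j → ∃[ t ] dist (p i) (p j) ≈ d t) )

-- r is the distance of exactly m unordered pairs of points, an unordered
-- pair {i , j} being represented by (i , j) with i < j.
HasMultiplicity : ∀ {n} → Config n → ℝ → ℕ → Set
HasMultiplicity {n} p r m = Σ[ ps ∈ List (Fin n × Fin n) ]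
  ( Unique ps
  × length ps ≡ m
  × (∀ i j → (i , j) ∈ ps ⇔ (i Fin.< j × dist (p i) (p j) ≈ r)) )

record StrongCrescent {n} (p : Config n) : Set where
  field
    distinct         : Injective _≡_ _≈²_ p
    general-position : StrongGeneralPosition p
    distances        : DeterminesDistances p (n ℕ.∸ 1)
    multiplicities   : ∀ m → 1 ℕ.≤ m → m ℕ.≤ n ℕ.∸ 1 → ∃[ r ] HasMultiplicity p r m

{-# OPTIONS --safe #-}
-- Every initial segment of the points (6,1), (1,2), (5,0), (7,0), (5,4), (0,3) of the
-- triangular lattice, where (u , v) stands for (u , v√3), is a strong crescent
-- configuration.  Squared distances u² + 3v² are rational, and so are the determinants
-- whose vanishing expresses collinearity and concyclicity, so every condition reduces
-- to a finite computation in ℚ.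
module Submission where

open import Defs
open import Data.Nat.Base using (ℕ; _≤_)
open import Data.Product using (Σ-syntax)

open import Data.Nat.Base as ℕ using (suc; s≤s)
import Data.Nat.Properties as ℕ
open import Data.Integer.Base using (+_)
open import Data.Rational.Base as ℚ using (ℚ; 0ℚ; 1ℚ; ½; _/_)
import Data.Rational.Properties as ℚ
open import Data.Rational.Solver using (module +-*-Solver)
open import Data.Fin.Base as Fin using (Fin; toℕ; fromℕ<)
open import Data.Fin.Patterns
import Data.Fin.Properties as Fin
open import Data.List.Base using (List; length; filter; cartesianProduct; allFin)
import Data.List.Membership.Propositional.Properties as ∈
import Data.List.Relation.Unary.Unique.Propositional.Properties as Unique
open import Data.Vec.Base using (Vec; []; _∷_; lookup; map)
open import Data.Product using (∃-syntax; _×_; _,_; proj₁; proj₂)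
open import Function.Base using (_∘_)
open import Function.Bundles using (_⇔_; _↣_; mk⇔; Bijection; Injection; Equivalence)
open import Function.Definitions using (Injective)
open import Relation.Binary.PropositionalEquality
  using (_≡_; _≢_; refl; sym; trans; cong; cong₂; subst)
open import Relation.Nullary using (¬_; Dec)
open import Relation.Nullary.Decidable using (_×-dec_; _→-dec_; ¬?; True; toWitness)

open Estimates
open √-Estimates
open +-*-Solver using (solve; _:=_; _:+_; _:*_; _:-_; con)

-- Null sequences of rationals and continuity of the square root.

-- x ≈ y says definitionally that seq x - seq y is null; as a record, Null determines f.
record Null (f : ℕ → ℚ) : Set where
  constructor null
  field vanishes : ∀ ε → 0ℚ ℚ.< ε → Σ[ N ∈ ℕ ] (∀ n → N ≤ n → ℚ.∣ f n ∣ ℚ.< ε)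

open Null

Null-resp : ∀ {f g} → (∀ n → f n ≡ g n) → Null f → Null g
Null-resp f≡g (null h) = null λ ε ε>0 →
  let N , lt = h ε ε>0
  in N , λ n N≤n → subst (λ q → ℚ.∣ q ∣ ℚ.< ε) (f≡g n) (lt n N≤n)

Null-+ : ∀ {f g} → Null f → Null g → Null (λ n → f n ℚ.+ g n)
Null-+ {f} {g} (null h) (null k) = null λ ε ε>0 →
  let N₁ , lt₁ = h (½ ℚ.* ε) (half-pos ε>0)
      N₂ , lt₂ = k (½ ℚ.* ε) (half-pos ε>0)
  in N₁ ℕ.⊔ N₂ , λ n N≤n → ℚ.≤-<-trans (ℚ.∣p+q∣≤∣p∣+∣q∣ (f n) (g n))
       (subst (ℚ.∣ f n ∣ ℚ.+ ℚ.∣ g n ∣ ℚ.<_) (half+half ε)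
         (ℚ.+-mono-< (lt₁ n (ℕ.m⊔n≤o⇒m≤o N₁ N₂ N≤n)) (lt₂ n (ℕ.m⊔n≤o⇒n≤o N₁ N₂ N≤n))))

Null-* : ∀ x {f} → Null f → Null (λ n → seq x n ℚ.* f n)
Null-* x {f} (null h) = null λ ε ε>0 →
  let B , B>0 , M , b = eventually-bounded x
      δ , δ>0 , eq = scale-pos B B>0 ε>0
      N , lt = h δ δ>0
      instance B-pos = ℚ.positive B>0
  in M ℕ.⊔ N , λ n ≤n →
     let M≤n = ℕ.m⊔n≤o⇒m≤o M N ≤n
         N≤n = ℕ.m⊔n≤o⇒n≤o M N ≤n
     in subst (ℚ._< ε) (sym (ℚ.∣p*q∣≡∣p∣*∣q∣ (seq x n) (f n)))
          (ℚ.≤-<-trans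
            (ℚ.*-monoʳ-≤-nonNeg ℚ.∣ f n ∣ {{ℚ.∣-∣-nonNeg (f n)}} (ℚ.<⇒≤ (b n M≤n)))
            (subst (B ℚ.* ℚ.∣ f n ∣ ℚ.<_) eq (ℚ.*-monoʳ-<-pos B (lt n N≤n))))

Null-scale : ∀ q {f} → Null f → Null (λ n → q ℚ.* f n)
Null-scale q = Null-* (fromℚ q)

Null-minus : ∀ {f g} → Null f → Null g → Null (λ n → f n ℚ.- g n)
Null-minus {f} {g} f→0 g→0 =
  Null-resp (λ n → identity (f n) (g n)) (Null-+ f→0 (Null-scale (ℚ.- 1ℚ) g→0))
  where
  identity : ∀ a b → a ℚ.+ ℚ.- 1ℚ ℚ.* b ≡ a ℚ.- b
  identity = solve 2 (λ a b → a :+ con (ℚ.- 1ℚ) :* b := a :- b) refl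

Null-cancel : ∀ {q f} → q ≢ 0ℚ → Null (λ n → q ℚ.* f n) → Null f
Null-cancel {q} {f} q≢0 qf→0 = Null-resp (λ n → inverse (f n)) (Null-scale (ℚ.1/ q) qf→0)
  where
  instance q-nonZero = ℚ.≢-nonZero q≢0
  inverse : ∀ y → ℚ.1/ q ℚ.* (q ℚ.* y) ≡ y
  inverse y = trans (sym (ℚ.*-assoc (ℚ.1/ q) q y))
                (trans (cong (ℚ._* y) (ℚ.*-inverseˡ q)) (ℚ.*-identityˡ y))

-- Here limits turn into exact rational equations: for nonzero `q`, taking `ε = ∣q∣` would give
-- `∣q∣ < ∣q∣`.
Null-const : ∀ {q} → Null (λ _ → q) → q ≡ 0ℚ
Null-const {q} (null h) = ℚ.∣p∣≡0⇒p≡0 q (ℚ.≤-antisym (ℚ.≮⇒≥ ∣q∣≯0) (ℚ.0≤∣p∣ q))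
  where
  ∣q∣≯0 : ¬ (0ℚ ℚ.< ℚ.∣ q ∣)
  ∣q∣≯0 ∣q∣>0 = let N , lt = h ℚ.∣ q ∣ ∣q∣>0 in ℚ.<-irrefl refl (lt N ℕ.≤-refl)

p-q≡0⇒p≡q : ∀ {p q} → p ℚ.- q ≡ 0ℚ → p ≡ q
p-q≡0⇒p≡q {p} {q} p-q≡0 =
  trans (sym (cancel p q)) (trans (cong (ℚ._+ q) p-q≡0) (ℚ.+-identityˡ q))
  where
  cancel : ∀ p q → (p ℚ.- q) ℚ.+ q ≡ p
  cancel = solve 2 (λ p q → (p :- q) :+ q := p) refl

-- Radicands closer than `δ²` have approximations closer than `2δ = ε` once `1/(n + 1) < δ`.
-- `√-approx-gap` bounds a signed difference, so it is applied in both orders.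
√-cong : ∀ x y → x ≈ y → √ x ≈ √ y
√-cong x y x≈y ε ε>0 =
  let δ      = ½ ℚ.* ε
      δ>0    = half-pos ε>0
      δ²>0   = ℚ.positive⁻¹ _ {{ℚ.pos*pos⇒pos δ {{ℚ.positive δ>0}} δ {{ℚ.positive δ>0}}}}
      N₁ , h = x≈y (δ ℚ.* δ) δ²>0
      N₂ , 1/ = 1/suc-small δ>0
  in N₁ ℕ.⊔ N₂ , λ n N≤n →
     let h′ = h n (ℕ.m⊔n≤o⇒m≤o N₁ N₂ N≤n)
         e  = 1/ n (ℕ.m⊔n≤o⇒n≤o N₁ N₂ N≤n)
     in ∣-∣<-intro (√-approx n (seq x n)) (√-approx n (seq y n))
          (subst (√-approx n (seq x n) ℚ.- √-approx n (seq y n) ℚ.<_) (half+half ε)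
            (√-approx-gap n n (seq x n) (seq y n) δ>0 e h′))
          (subst (√-approx n (seq y n) ℚ.- √-approx n (seq x n) ℚ.<_) (half+half ε)
            (√-approx-gap n n (seq y n) (seq x n) δ>0 e
              (subst (ℚ._< δ ℚ.* δ) (∣-∣-sym (seq x n) (seq y n)) h′)))

-- Lattice coordinates and squared Euclidean distances.

3ℚ : ℚ
3ℚ = + 3 / 1

-- Opaque, so that conversion checking does not unfold the approximations of √3.
opaque
  √3 : ℝ
  √3 = √ fromℚ 3ℚ

  √3-square : Null (λ n → seq √3 n ℚ.* seq √3 n ℚ.- 3ℚ)
  √3-square = null (√-square (fromℚ 3ℚ) λ _ → ℚ.nonNegative⁻¹ 3ℚ)

embed : ℚ × ℚ → ℝ²
embed (u , v) = fromℚ u , fromℚ v * √3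

infixl 6 _⊖_

_⊖_ : ℚ × ℚ → ℚ × ℚ → ℚ × ℚ
(u , v) ⊖ (u′ , v′) = u ℚ.- u′ , v ℚ.- v′

norm : ℚ × ℚ → ℚ
norm (u , v) = u ℚ.* u ℚ.+ 3ℚ ℚ.* (v ℚ.* v)

dist² : ℚ × ℚ → ℚ × ℚ → ℚ
dist² z w = norm (z ⊖ w)

-- The cross product in lattice coordinates. The Euclidean one is √3 times it, so the two vanish
-- together, and this one is rational.
area : ℚ × ℚ → ℚ × ℚ → ℚ
area (a , b) (c , d) = a ℚ.* d ℚ.- b ℚ.* c

-- Definitionally the radicand of `dist`, so `‖‖-square` and `√-cong` apply without rewriting.
sqDist : ℝ² → ℝ² → ℝ
sqDist (x , y) (x′ , y′) = (x - x′) * (x - x′) + (y - y′) * (y - y′)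

dist-square : ∀ p q → Null (λ n → seq (dist p q) n ℚ.* seq (dist p q) n ℚ.- seq (sqDist p q) n)
dist-square (x , y) (x′ , y′) = null (‖‖-square (x - x′) (y - y′))

-- With s the n-th approximation of √3, the error is exactly (v - v′)²(s² - 3).
sqDist-embed : ∀ z w → Null (λ n → seq (sqDist (embed z) (embed w)) n ℚ.- dist² z w)
sqDist-embed (u , v) (u′ , v′) =
  Null-resp (λ n → identity (u ℚ.- u′) v v′ (seq √3 n))
    (Null-scale ((v ℚ.- v′) ℚ.* (v ℚ.- v′)) √3-square)
  where
  identity : ∀ a v v′ s →
    ((v ℚ.- v′) ℚ.* (v ℚ.- v′)) ℚ.* (s ℚ.* s ℚ.- 3ℚ) ≡
    (a ℚ.* a ℚ.+ (v ℚ.* s ℚ.- v′ ℚ.* s) ℚ.* (v ℚ.* s ℚ.- v′ ℚ.* s))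
      ℚ.- (a ℚ.* a ℚ.+ 3ℚ ℚ.* ((v ℚ.- v′) ℚ.* (v ℚ.- v′)))
  identity = solve 4 (λ a v v′ s →
    ((v :- v′) :* (v :- v′)) :* (s :* s :- con 3ℚ) :=
    (a :* a :+ (v :* s :- v′ :* s) :* (v :* s :- v′ :* s))
      :- (a :* a :+ con 3ℚ :* ((v :- v′) :* (v :- v′)))) refl

-- Forwards, (d + d′)(d - d′) is null, so the limits of d² and d′² agree, and these are the
-- rationals compared. Backwards, equal limits make the radicands equivalent, and `√-cong` finishes.
dist-embed : ∀ z w z′ w′ →
             dist (embed z) (embed w) ≈ dist (embed z′) (embed w′) ⇔ dist² z w ≡ dist² z′ w′
dist-embed z w z′ w′ = mk⇔ to from
  where
  d  = dist (embed z) (embed w)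
  d′ = dist (embed z′) (embed w′)
  to : d ≈ d′ → dist² z w ≡ dist² z′ w′
  to d≈d′ = p-q≡0⇒p≡q (Null-const (Null-resp
    (λ n → identity (seq d n) (seq (sqDist (embed z) (embed w)) n) (dist² z w)
                    (seq d′ n) (seq (sqDist (embed z′) (embed w′)) n) (dist² z′ w′))
    (Null-minus
      (Null-minus
        (Null-* (d + d′) (null d≈d′))
        (Null-+ (dist-square (embed z) (embed w)) (sqDist-embed z w)))
      (Null-scale (ℚ.- 1ℚ)
        (Null-+ (dist-square (embed z′) (embed w′)) (sqDist-embed z′ w′))))))
    where
    identity : ∀ d N D d′ N′ D′ →
      ((d ℚ.+ d′) ℚ.* (d ℚ.- d′) ℚ.- ((d ℚ.* d ℚ.- N) ℚ.+ (N ℚ.- D)))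
        ℚ.- (ℚ.- 1ℚ) ℚ.* ((d′ ℚ.* d′ ℚ.- N′) ℚ.+ (N′ ℚ.- D′)) ≡ D ℚ.- D′
    identity = solve 6 (λ d N D d′ N′ D′ →
      ((d :+ d′) :* (d :- d′) :- ((d :* d :- N) :+ (N :- D)))
        :- con (ℚ.- 1ℚ) :* ((d′ :* d′ :- N′) :+ (N′ :- D′)) := D :- D′) refl
  from : dist² z w ≡ dist² z′ w′ → d ≈ d′
  from D≡D′ = √-cong N N′ (vanishes (Null-resp
    (λ n → identity (seq N n) (seq N′ n) (dist² z w) (dist² z′ w′) D≡D′)
    (Null-minus (sqDist-embed z w) (sqDist-embed z′ w′))))
    where
    N  = sqDist (embed z) (embed w)
    N′ = sqDist (embed z′) (embed w′)
    cancel : ∀ a b D → (a ℚ.- D) ℚ.- (b ℚ.- D) ≡ a ℚ.- b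
    cancel = solve 3 (λ a b D → (a :- D) :- (b :- D) := a :- b) refl
    identity : ∀ a b D D′ → D ≡ D′ → (a ℚ.- D) ℚ.- (b ℚ.- D′) ≡ a ℚ.- b
    identity a b D .D refl = cancel a b D

embed≈⇒dist²≡0 : ∀ z w → embed z ≈² embed w → dist² z w ≡ 0ℚ
embed≈⇒dist²≡0 z w (x≈x′ , y≈y′) = Null-const (Null-resp
  (λ n → identity (seq (x - x′) n) (seq (y - y′) n) (dist² z w))
  (Null-minus
    (Null-+ (Null-* (x - x′) (null x≈x′)) (Null-* (y - y′) (null y≈y′)))
    (sqDist-embed z w)))
  where
  x  = proj₁ (embed z)
  y  = proj₂ (embed z)
  x′ = proj₁ (embed w)
  y′ = proj₂ (embed w)
  identity : ∀ a b D → (a ℚ.* a ℚ.+ b ℚ.* b) ℚ.- ((a ℚ.* a ℚ.+ b ℚ.* b) ℚ.- D) ≡ D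
  identity = solve 3 (λ a b D → (a :* a :+ b :* b) :- ((a :* a :+ b :* b) :- D) := D) refl

-- Collinearity and concyclicity by elimination.

form : ℚ × ℚ → (ℕ → ℚ) → (ℕ → ℚ) → ℕ → ℚ
form (a , b) f g n = a ℚ.* f n ℚ.+ b ℚ.* g n

-- Eliminating either unknown leaves the other multiplied by the determinant `area z w`, which can
-- be cancelled.
cramer : ∀ z w {f g} → area z w ≢ 0ℚ → Null (form z f g) → Null (form w f g) → Null f × Null g
cramer (a , b) (c , d) {f} {g} D≢0 h₁ h₂ =
    Null-cancel D≢0 (Null-resp (λ n → first a b c d (f n) (g n))
      (Null-minus (Null-scale d h₁) (Null-scale b h₂)))
  , Null-cancel D≢0 (Null-resp (λ n → second a b c d (f n) (g n))
      (Null-minus (Null-scale a h₂) (Null-scale c h₁)))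
  where
  first : ∀ a b c d f g →
    d ℚ.* (a ℚ.* f ℚ.+ b ℚ.* g) ℚ.- b ℚ.* (c ℚ.* f ℚ.+ d ℚ.* g) ≡ (a ℚ.* d ℚ.- b ℚ.* c) ℚ.* f
  first = solve 6 (λ a b c d f g →
    d :* (a :* f :+ b :* g) :- b :* (c :* f :+ d :* g) := (a :* d :- b :* c) :* f) refl
  second : ∀ a b c d f g →
    a ℚ.* (c ℚ.* f ℚ.+ d ℚ.* g) ℚ.- c ℚ.* (a ℚ.* f ℚ.+ b ℚ.* g) ≡ (a ℚ.* d ℚ.- b ℚ.* c) ℚ.* g
  second = solve 6 (λ a b c d f g →
    a :* (c :* f :+ d :* g) :- c :* (a :* f :+ b :* g) := (a :* d :- b :* c) :* g) refl

-- Subtracting the line equation at z₀ from the other two gives a homogeneous system in a and b√3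
-- with determinant `area`. Its only solution is zero, which contradicts `nondegenerate`.
¬collinear : ∀ z₀ z₁ z₂ → area (z₁ ⊖ z₀) (z₂ ⊖ z₀) ≢ 0ℚ →
             ∀ ℓ → embed z₀ onLine ℓ → embed z₁ onLine ℓ → ¬ (embed z₂ onLine ℓ)
¬collinear z₀ z₁ z₂ D≢0 ℓ on₀ on₁ on₂ =
  let a→0 , t→0 = cramer (z₁ ⊖ z₀) (z₂ ⊖ z₀) {seq a} {t} D≢0 (difference z₁ on₁) (difference z₂ on₂)
  in nondegenerate (vanishes (Null-resp (λ n → sym (minus-0 (seq a n))) a→0)
                   , vanishes (Null-resp (λ n → sym (minus-0 (seq b n))) (b→0 t→0)))
  where
  open Line ℓ
  t : ℕ → ℚ
  t n = seq b n ℚ.* seq √3 n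
  minus-0 : ∀ q → q ℚ.- 0ℚ ≡ q
  minus-0 = ℚ.+-identityʳ
  difference : ∀ z → embed z onLine ℓ → Null (form (z ⊖ z₀) (seq a) t)
  difference (u , v) on = Null-resp
    (λ n → identity (seq a n) (seq b n) (seq c n) (seq √3 n) u v (proj₁ z₀) (proj₂ z₀))
    (Null-minus (null on) (null on₀))
    where
    identity : ∀ a b c s u v u₀ v₀ →
      (a ℚ.* u ℚ.+ b ℚ.* (v ℚ.* s) ℚ.- c) ℚ.- (a ℚ.* u₀ ℚ.+ b ℚ.* (v₀ ℚ.* s) ℚ.- c)
      ≡ (u ℚ.- u₀) ℚ.* a ℚ.+ (v ℚ.- v₀) ℚ.* (b ℚ.* s)
    identity = solve 8 (λ a b c s u v u₀ v₀ →
      (a :* u :+ b :* (v :* s) :- c) :- (a :* u₀ :+ b :* (v₀ :* s) :- c)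
      := (u :- u₀) :* a :+ (v :- v₀) :* (b :* s)) refl
  b→0 : Null t → Null (seq b)
  -- Multiplying b√3 by √3 again gives 3b, so only the rational 3 has to be inverted.
  b→0 t→0 = Null-cancel {3ℚ} (λ ()) (Null-resp (λ n → identity (seq b n) (seq √3 n))
    (Null-minus (Null-* √3 t→0) (Null-* b √3-square)))
    where
    identity : ∀ b s → s ℚ.* (b ℚ.* s) ℚ.- b ℚ.* (s ℚ.* s ℚ.- 3ℚ) ≡ 3ℚ ℚ.* b
    identity = solve 2 (λ b s → s :* (b :* s) :- b :* (s :* s :- con 3ℚ) := con 3ℚ :* b) refl

-- The 3×3 determinant whose rows are the norm and the two coordinates of z, w and t, expanded along
-- the norm column.
circular : ℚ × ℚ → ℚ × ℚ → ℚ × ℚ → ℚ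
circular z w t = (area w t ℚ.* norm z ℚ.+ area t z ℚ.* norm w) ℚ.+ area z w ℚ.* norm t

-- The three areas are the coefficients of the linear dependence between z, w and t in the plane, so
-- the forms cancel identically and a null constant remains.
eliminate : ∀ {p q r f g} z w t →
  Null (λ n → p ℚ.+ form z f g n) → Null (λ n → q ℚ.+ form w f g n) →
  Null (λ n → r ℚ.+ form t f g n) →
  (area w t ℚ.* p ℚ.+ area t z ℚ.* q) ℚ.+ area z w ℚ.* r ≡ 0ℚ
eliminate {p} {q} {r} {f} {g} z@(a , b) w@(a′ , b′) t@(a″ , b″) h h′ h″ = Null-const (Null-resp
  (λ n → identity p q r a b a′ b′ a″ b″ (f n) (g n))
  (Null-+ (Null-+ (Null-scale (area w t) h) (Null-scale (area t z) h′)) (Null-scale (area z w) h″)))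
  where
  identity : ∀ p q r a b a′ b′ a″ b″ f g →
    ((a′ ℚ.* b″ ℚ.- b′ ℚ.* a″) ℚ.* (p ℚ.+ (a ℚ.* f ℚ.+ b ℚ.* g))
      ℚ.+ (a″ ℚ.* b ℚ.- b″ ℚ.* a) ℚ.* (q ℚ.+ (a′ ℚ.* f ℚ.+ b′ ℚ.* g)))
      ℚ.+ (a ℚ.* b′ ℚ.- b ℚ.* a′) ℚ.* (r ℚ.+ (a″ ℚ.* f ℚ.+ b″ ℚ.* g))
    ≡ ((a′ ℚ.* b″ ℚ.- b′ ℚ.* a″) ℚ.* p ℚ.+ (a″ ℚ.* b ℚ.- b″ ℚ.* a) ℚ.* q)
      ℚ.+ (a ℚ.* b′ ℚ.- b ℚ.* a′) ℚ.* r
  identity = solve 11 (λ p q r a b a′ b′ a″ b″ f g →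
    ((a′ :* b″ :- b′ :* a″) :* (p :+ (a :* f :+ b :* g))
      :+ (a″ :* b :- b″ :* a) :* (q :+ (a′ :* f :+ b′ :* g)))
      :+ (a :* b′ :- b :* a′) :* (r :+ (a″ :* f :+ b″ :* g))
    := ((a′ :* b″ :- b′ :* a″) :* p :+ (a″ :* b :- b″ :* a) :* q)
      :+ (a :* b′ :- b :* a′) :* r) refl

-- Subtracting the circle equation of z₀ from the others leaves three affine equations in
-- the coordinates of 2(z₀ - centre) (the second one times √3), whose compatibility determinant is `circular`.
¬concyclic : ∀ z₀ z₁ z₂ z₃ → circular (z₁ ⊖ z₀) (z₂ ⊖ z₀) (z₃ ⊖ z₀) ≢ 0ℚ →
             ∀ C → embed z₀ onCircle C → embed z₁ onCircle C → embed z₂ onCircle C →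
             ¬ (embed z₃ onCircle C)
¬concyclic z₀@(u₀ , v₀) z₁ z₂ z₃ D≢0 C on₀ on₁ on₂ on₃ =
  D≢0 (eliminate {f = f} {g} (z₁ ⊖ z₀) (z₂ ⊖ z₀) (z₃ ⊖ z₀)
        (difference z₁ on₁) (difference z₂ on₂) (difference z₃ on₃))
  where
  open Circle C
  X = seq (proj₁ centre)
  Y = seq (proj₂ centre)
  r = seq radius
  f g : ℕ → ℚ
  f n = (u₀ ℚ.- X n) ℚ.+ (u₀ ℚ.- X n)
  g n = seq √3 n ℚ.* ((v₀ ℚ.* seq √3 n ℚ.- Y n) ℚ.+ (v₀ ℚ.* seq √3 n ℚ.- Y n))
  squared : ∀ z → embed z onCircle C →
            Null (λ n → seq (sqDist (embed z) centre) n ℚ.- r n ℚ.* r n)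
  squared z on = Null-resp
    (λ n → identity (seq d n) (r n) (seq (sqDist (embed z) centre) n))
    (Null-minus (Null-* (d + radius) (null on)) (dist-square (embed z) centre))
    where
    d = dist (embed z) centre
    identity : ∀ d r N → (d ℚ.+ r) ℚ.* (d ℚ.- r) ℚ.- (d ℚ.* d ℚ.- N) ≡ N ℚ.- r ℚ.* r
    identity = solve 3 (λ d r N → (d :+ r) :* (d :- r) :- (d :* d :- N) := N :- r :* r) refl
  difference : ∀ z → embed z onCircle C → Null (λ n → norm (z ⊖ z₀) ℚ.+ form (z ⊖ z₀) f g n)
  difference z@(u , v) on = Null-resp
    (λ n → identity u v u₀ v₀ (X n) (Y n) (seq √3 n) (r n ℚ.* r n))
    (Null-minus (Null-minus (squared z on) (squared z₀ on₀))
      -- Turns the leftover (v - v₀)²s² into the 3(v - v₀)² of `norm`.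
      (Null-scale ((v ℚ.- v₀) ℚ.* (v ℚ.- v₀)) √3-square))
    where
    identity : ∀ u v u₀ v₀ X Y s R →
      ((((u ℚ.- X) ℚ.* (u ℚ.- X) ℚ.+ (v ℚ.* s ℚ.- Y) ℚ.* (v ℚ.* s ℚ.- Y)) ℚ.- R)
        ℚ.- (((u₀ ℚ.- X) ℚ.* (u₀ ℚ.- X) ℚ.+ (v₀ ℚ.* s ℚ.- Y) ℚ.* (v₀ ℚ.* s ℚ.- Y)) ℚ.- R))
        ℚ.- ((v ℚ.- v₀) ℚ.* (v ℚ.- v₀)) ℚ.* (s ℚ.* s ℚ.- 3ℚ)
      ≡ ((u ℚ.- u₀) ℚ.* (u ℚ.- u₀) ℚ.+ 3ℚ ℚ.* ((v ℚ.- v₀) ℚ.* (v ℚ.- v₀)))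
        ℚ.+ ((u ℚ.- u₀) ℚ.* ((u₀ ℚ.- X) ℚ.+ (u₀ ℚ.- X))
          ℚ.+ (v ℚ.- v₀) ℚ.* (s ℚ.* ((v₀ ℚ.* s ℚ.- Y) ℚ.+ (v₀ ℚ.* s ℚ.- Y))))
    identity = solve 8 (λ u v u₀ v₀ X Y s R →
      ((((u :- X) :* (u :- X) :+ (v :* s :- Y) :* (v :* s :- Y)) :- R)
        :- (((u₀ :- X) :* (u₀ :- X) :+ (v₀ :* s :- Y) :* (v₀ :* s :- Y)) :- R))
        :- ((v :- v₀) :* (v :- v₀)) :* (s :* s :- con 3ℚ)
      := ((u :- u₀) :* (u :- u₀) :+ con 3ℚ :* ((v :- v₀) :* (v :- v₀)))
        :+ ((u :- u₀) :* ((u₀ :- X) :+ (u₀ :- X))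
          :+ (v :- v₀) :* (s :* ((v₀ :* s :- Y) :+ (v₀ :* s :- Y))))) refl

-- Decidable conditions on rational coordinates.

Distinct₃ : ∀ {n} (i j k : Fin n) → Set
Distinct₃ i j k = i ≢ j × i ≢ k × j ≢ k

Distinct₄ : ∀ {n} (i j k l : Fin n) → Set
Distinct₄ i j k l = Distinct₃ i j k × i ≢ l × j ≢ l × k ≢ l

distinct₃? : ∀ {n} (i j k : Fin n) → Dec (Distinct₃ i j k)
distinct₃? i j k = ¬? (i Fin.≟ j) ×-dec ¬? (i Fin.≟ k) ×-dec ¬? (j Fin.≟ k)

distinct₄? : ∀ {n} (i j k l : Fin n) → Dec (Distinct₄ i j k l)
distinct₄? i j k l =
  distinct₃? i j k ×-dec ¬? (i Fin.≟ l) ×-dec ¬? (j Fin.≟ l) ×-dec ¬? (k Fin.≟ l)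

injective⇒≢ : ∀ {m n} (s : Fin m ↣ Fin n) {i j} → i ≢ j → Injection.to s i ≢ Injection.to s j
injective⇒≢ s i≢j = i≢j ∘ Injection.injective s

module _ {n} (z : Fin n → ℚ × ℚ) where

  length² : Fin n → Fin n → ℚ
  length² i j = dist² (z i) (z j)

  Separated : Set
  Separated = ∀ i j → length² i j ≡ 0ℚ → i ≡ j

  NoThreeCollinear : Set
  NoThreeCollinear = ∀ i j k → Distinct₃ i j k → area (z j ⊖ z i) (z k ⊖ z i) ≢ 0ℚ

  NoFourConcyclic : Set
  NoFourConcyclic = ∀ i j k l → Distinct₄ i j k l →
                    circular (z j ⊖ z i) (z k ⊖ z i) (z l ⊖ z i) ≢ 0ℚ

  -- These equalities are forced when i, j, k, l carry consecutive labels. Quantifying over ordered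
  -- quadruples covers every labelling.
  NoFourLineLike : Set
  NoFourLineLike = ∀ i j k l → Distinct₄ i j k l →
    ¬ (length² i j ≡ length² j k × length² j k ≡ length² k l × length² i k ≡ length² j l)

  separated? : Dec Separated
  separated? = Fin.all? λ i → Fin.all? λ j → (length² i j ℚ.≟ 0ℚ) →-dec (i Fin.≟ j)

  noThreeCollinear? : Dec NoThreeCollinear
  noThreeCollinear? = Fin.all? λ i → Fin.all? λ j → Fin.all? λ k →
    distinct₃? i j k →-dec ¬? (area (z j ⊖ z i) (z k ⊖ z i) ℚ.≟ 0ℚ)

  noFourConcyclic? : Dec NoFourConcyclic
  noFourConcyclic? = Fin.all? λ i → Fin.all? λ j → Fin.all? λ k → Fin.all? λ l →
    distinct₄? i j k l →-dec ¬? (circular (z j ⊖ z i) (z k ⊖ z i) (z l ⊖ z i) ℚ.≟ 0ℚ)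

  noFourLineLike? : Dec NoFourLineLike
  noFourLineLike? = Fin.all? λ i → Fin.all? λ j → Fin.all? λ k → Fin.all? λ l →
    distinct₄? i j k l →-dec ¬? ((length² i j ℚ.≟ length² j k) ×-dec
      (length² j k ℚ.≟ length² k l) ×-dec (length² i k ℚ.≟ length² j l))

  edges : ℚ → List (Fin n × Fin n)
  edges q = filter (λ (i , j) → (i Fin.<? j) ×-dec (length² i j ℚ.≟ q))
                   (cartesianProduct (allFin n) (allFin n))

  -- Transfer from the rational conditions to the real configuration.

  separation : Fin n → Fin n → ℝ
  separation i j = dist (embed (z i)) (embed (z j))

  separation-≈ : ∀ i j k l → separation i j ≈ separation k l ⇔ length² i j ≡ length² k l
  separation-≈ i j k l = dist-embed (z i) (z j) (z k) (z l)

  -- The multiplicity is the length of a computed list, so it can later be checked by evaluation.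
  hasMultiplicity : ∀ i j →
    HasMultiplicity (embed ∘ z) (separation i j) (length (edges (length² i j)))
  hasMultiplicity i j =
      edges (length² i j)
    , Unique.filter⁺ P? (Unique.cartesianProduct⁺ (Unique.allFin⁺ n) (Unique.allFin⁺ n))
    , refl
    , λ k l → mk⇔
        (λ kl∈ → let k<l , eq = proj₂ (∈.∈-filter⁻ P? {xs = pairs} kl∈)
                 in k<l , Equivalence.from (separation-≈ k l i j) eq)
        (λ (k<l , eq) → ∈.∈-filter⁺ P? (∈.∈-cartesianProduct⁺ (∈.∈-allFin k) (∈.∈-allFin l))
                          (k<l , Equivalence.to (separation-≈ k l i j) eq))
    where
    pairs = cartesianProduct (allFin n) (allFin n)
    P? = λ ((k , l) : Fin n × Fin n) → (k Fin.<? l) ×-dec (length² k l ℚ.≟ length² i j)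

  embed-distinct : Separated → Injective _≡_ _≈²_ (embed ∘ z)
  embed-distinct separated {i} {j} zi≈zj = separated i j (embed≈⇒dist²≡0 (z i) (z j) zi≈zj)

  no-line-like : NoFourLineLike → (s : Fin 4 ↣ Fin n) → ¬ LineLike (embed ∘ z ∘ Injection.to s)
  no-line-like noLineLike s (φ , equidistant) = noLineLike (x 0F) (x 1F) (x 2F) (x 3F)
    ( (x-≢ (λ ()) , x-≢ (λ ()) , x-≢ (λ ())) , x-≢ (λ ()) , x-≢ (λ ()) , x-≢ (λ ()))
    (equal 0F 1F 1F 2F refl , equal 1F 2F 2F 3F refl , equal 0F 2F 1F 3F refl)
    where
    open Bijection φ using (to; strictlySurjective)
    -- `y` inverts the labelling, so `x` lists the four points by increasing label.
    y : Fin 4 → Fin 4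
    y k = proj₁ (strictlySurjective k)
    to-y : ∀ k → to (y k) ≡ k
    to-y k = proj₂ (strictlySurjective k)
    x : Fin 4 → Fin n
    x k = Injection.to s (y k)
    x-≢ : ∀ {k l} → k ≢ l → x k ≢ x l
    x-≢ {k} {l} k≢l = injective⇒≢ s λ yk≡yl →
      k≢l (trans (sym (to-y k)) (trans (cong to yk≡yl) (to-y l)))
    label-difference : ∀ k l → ℕ.∣ toℕ (to (y k)) - toℕ (to (y l)) ∣ ≡ ℕ.∣ toℕ k - toℕ l ∣
    label-difference k l = cong₂ (λ a b → ℕ.∣ toℕ a - toℕ b ∣) (to-y k) (to-y l)
    equal : ∀ a b c d → ℕ.∣ toℕ a - toℕ b ∣ ≡ ℕ.∣ toℕ c - toℕ d ∣ →
            length² (x a) (x b) ≡ length² (x c) (x d)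
    equal a b c d eq = Equivalence.to (separation-≈ (x a) (x b) (x c) (x d))
      (Equivalence.from (equidistant (y a) (y b) (y c) (y d))
        (trans (label-difference a b) (trans eq (sym (label-difference c d)))))

  generalPosition : NoThreeCollinear → NoFourConcyclic → NoFourLineLike →
                    StrongGeneralPosition (embed ∘ z)
  generalPosition noCollinear noConcyclic noLineLike = record
    { no-3-collinear = λ s (ℓ , on) → let x = Injection.to s in
        ¬collinear (z (x 0F)) (z (x 1F)) (z (x 2F))
          (noCollinear (x 0F) (x 1F) (x 2F)
            (injective⇒≢ s (λ ()) , injective⇒≢ s (λ ()) , injective⇒≢ s (λ ())))
          ℓ (on 0F) (on 1F) (on 2F)
    ; no-4-concyclic = λ s (C , on) → let x = Injection.to s in
        ¬concyclic (z (x 0F)) (z (x 1F)) (z (x 2F)) (z (x 3F))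
          (noConcyclic (x 0F) (x 1F) (x 2F) (x 3F)
            ( (injective⇒≢ s (λ ()) , injective⇒≢ s (λ ()) , injective⇒≢ s (λ ()))
            , injective⇒≢ s (λ ()) , injective⇒≢ s (λ ()) , injective⇒≢ s (λ ())))
          C (on 0F) (on 1F) (on 2F) (on 3F)
    ; no-4-line-like = no-line-like noLineLike
    }

  -- e t is a pair of points whose distance has multiplicity t + 1.
  module _ (e : Fin (n ℕ.∸ 1) → Fin n × Fin n) where

    a b : Fin (n ℕ.∸ 1) → Fin n
    a = proj₁ ∘ e
    b = proj₂ ∘ e

    edge² : Fin (n ℕ.∸ 1) → ℚ
    edge² t = length² (a t) (b t)

    Represents : Set
    Represents =
      (∀ t → a t ≢ b t) ×
      (∀ s t → edge² s ≡ edge² t → s ≡ t) ×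
      (∀ i j → i ≢ j → ∃[ t ] length² i j ≡ edge² t) ×
      (∀ t → length (edges (edge² t)) ≡ suc (toℕ t))

    represents? : Dec Represents
    represents? =
      (Fin.all? λ t → ¬? (a t Fin.≟ b t)) ×-dec
      (Fin.all? λ s → Fin.all? λ t → (edge² s ℚ.≟ edge² t) →-dec (s Fin.≟ t)) ×-dec
      (Fin.all? λ i → Fin.all? λ j →
        ¬? (i Fin.≟ j) →-dec Fin.any? λ t → length² i j ℚ.≟ edge² t) ×-dec
      (Fin.all? λ t → length (edges (edge² t)) ℕ.≟ suc (toℕ t))

    LatticeCrescent : Set
    LatticeCrescent =
      Separated × NoThreeCollinear × NoFourConcyclic × NoFourLineLike × Represents

    latticeCrescent? : Dec LatticeCrescent
    latticeCrescent? = separated? ×-dec noThreeCollinear? ×-dec noFourConcyclic?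
                       ×-dec noFourLineLike? ×-dec represents?

    strongCrescent : LatticeCrescent → StrongCrescent (embed ∘ z)
    strongCrescent (separated , noCollinear , noConcyclic , noLineLike ,
                    proper , injective , complete , multiplicity) = record
      { distinct         = embed-distinct separated
      ; general-position = generalPosition noCollinear noConcyclic noLineLike
      ; distances        =
            d
          , (λ {s} {t} → injective s t ∘ Equivalence.to (separation-≈ (a s) (b s) (a t) (b t)))
          , (λ t → a t , b t , proper t
                 , Equivalence.from (separation-≈ (a t) (b t) (a t) (b t)) refl)
          , (λ i j i≢j → let t , eq = complete i j i≢j
                         in t , Equivalence.from (separation-≈ i j (a t) (b t)) eq)
      -- `suc m ≤ n ∸ 1` is definitionally `m < n ∸ 1`, so multiplicity m + 1 sits at index m.
      ; multiplicities   = λ { (suc m) _ m<n-1 → let t = fromℕ< m<n-1 in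
          d t , subst (HasMultiplicity (embed ∘ z) (d t))
                  (trans (multiplicity t) (cong suc (Fin.toℕ-fromℕ< m<n-1)))
                  (hasMultiplicity (a t) (b t)) }
      }
      where
      d : Fin (n ℕ.∸ 1) → ℝ
      d t = separation (a t) (b t)

-- The six points and the check by evaluation.

points : Vec (ℚ × ℚ) 6
points = map (λ (u , v) → + u / 1 , + v / 1)
  -- The squared distances 76, 52, 48, 4, 28 occur 1, 2, 3, 4, 5 times.
  ((6 , 1) ∷ (1 , 2) ∷ (5 , 0) ∷ (7 , 0) ∷ (5 , 4) ∷ (0 , 3) ∷ [])

initial : ∀ {n} → n ≤ 6 → Fin n → ℚ × ℚ
initial n≤6 i = lookup points (Fin.inject≤ i n≤6)

-- `True` of a positive decision reduces to the unit type, so each `_` passed for it is solved by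
-- evaluating the finite check.
initialSegment : ∀ n (n≤6 : n ≤ 6) (e : Vec (Fin n × Fin n) (n ℕ.∸ 1)) →
  True (latticeCrescent? (initial n≤6) (lookup e)) → Σ[ p ∈ Config n ] StrongCrescent p
initialSegment n n≤6 e holds =
  embed ∘ initial n≤6 , strongCrescent (initial n≤6) (lookup e) (toWitness holds)

theorem1p8 : ∀ (n : ℕ) → 1 ≤ n → n ≤ 6 → Σ[ p ∈ Config n ] StrongCrescent p
theorem1p8 1 _ n≤6 = initialSegment 1 n≤6 [] _
theorem1p8 2 _ n≤6 = initialSegment 2 n≤6 ((0F , 1F) ∷ []) _
-- The pairs represent squared distances in order of multiplicity: 4, 28 here, then 48, 28, 4 for
-- four points and 52, 48, 4, 28 for five.
theorem1p8 3 _ n≤6 = initialSegment 3 n≤6 ((0F , 2F) ∷ (0F , 1F) ∷ []) _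
theorem1p8 4 _ n≤6 = initialSegment 4 n≤6 ((1F , 3F) ∷ (0F , 1F) ∷ (0F , 2F) ∷ []) _
theorem1p8 5 _ n≤6 =
  initialSegment 5 n≤6 ((3F , 4F) ∷ (1F , 3F) ∷ (0F , 2F) ∷ (0F , 1F) ∷ []) _
theorem1p8 6 _ n≤6 =
  initialSegment 6 n≤6 ((3F , 5F) ∷ (2F , 5F) ∷ (1F , 3F) ∷ (0F , 2F) ∷ (0F , 1F) ∷ []) _
theorem1p8 (suc (suc (suc (suc (suc (suc (suc n))))))) _
  (s≤s (s≤s (s≤s (s≤s (s≤s (s≤s ()))))))
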